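{- Let $B$ be a barrier on an infinite set $X\subseteq\mathbb{N}$ and let $k\in\mathbb{N}$. For every $k$-bounded function $f:B\to\mathbb{N}$ there exists a barrier $B'\subseteq B$ such that $f$ is injective on $B'$.
   Context: $\mathbb{N}$ is the set of natural numbers (including $0$). Subsets of $\mathbb{N}$ are identified with their strictly increasing enumerations; $s\sqsubset Y$ means that $s$ is a proper initial segment of $Y$ as a sequence; $\subset$ is strict set inclusion. A set $B$ of finite subsets of $\mathbb{N}$ is a barrier on an infinite set $X\subseteq\mathbb{N}$ if: (1) $\bigcup B=X$; (2) for all $s,t\in B$, $s\not\subset t$; (3) for every infinite $Y\subseteq X$ there is $s\in B$ with $s\sqsubset Y$. The set $b(B)=\bigcup B$ is called the base of $B$. A family $B'$ is called a barrier if it is a barrier on its base $b(B')$ (in particular $b(B')$ is infinite). A function $f:B\to\mathbb{N}$ is $k$-bounded if $|f^{ -1}(x)|\le k$ for every $x\in\mathbb{N}$. -}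

module Defs where

open import Data.Fin.Base using (Fin)
open import Data.List.Base using (List; applyUpTo)
open import Data.List.Membership.Propositional using () renaming (_∈_ to _∈ˡ_)
open import Data.List.Relation.Binary.Subset.Propositional using () renaming (_⊆_ to _⊆ˡ_)
open import Data.List.Relation.Unary.Linked using (Linked)
open import Data.Nat.Base using (ℕ; _<_)
open import Data.Product.Base using (_×_; ∃; ∃-syntax)
open import Data.Refinement.Base using (Refinement-syntax; value)
open import Function.Bundles using (_↣_)
open import Level using (0ℓ)
open import Relation.Binary.Core using (_Preserves_⟶_)
open import Relation.Binary.PropositionalEquality.Core using (_≡_; _≢_)
open import Relation.Nullary.Negation.Core using (¬_)
open import Relation.Unary using (Pred; _∈_; _⊆_; _≐_)

-- Finite and infinite subsets of ℕ are identified with their strictly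
-- increasing enumerations. The sortedness proof in FinSet is irrelevant, so
-- propositional equality of finite sets is equality of the underlying lists.

FinSet : Set
FinSet = [ xs ∈ List ℕ ∣ Linked _<_ xs ]

record InfSet : Set where
  field
    enum       : ℕ → ℕ
    increasing : enum Preserves _<_ ⟶ _<_

open InfSet public

elements : InfSet → Pred ℕ 0ℓ
elements Y n = ∃[ i ] enum Y i ≡ n

infix 4 _⊂ᶠ_ _⊏_

_⊂ᶠ_ : FinSet → FinSet → Set
s ⊂ᶠ t = value s ⊆ˡ value t × s ≢ t

-- A finite initial segment of an infinite sequence is automatically proper.

_⊏_ : FinSet → InfSet → Set
s ⊏ Y = ∃[ n ] value s ≡ applyUpTo (enum Y) n

Family : Set₁
Family = Pred FinSet 0ℓ

base : Family → Pred ℕ 0ℓ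
base B n = ∃[ s ] s ∈ B × n ∈ˡ value s

record IsBarrierOn (X : InfSet) (B : Family) : Set where
  field
    covers    : base B ≐ elements X
    antichain : ∀ {s t} → s ∈ B → t ∈ B → ¬ (s ⊂ᶠ t)
    meets     : ∀ Y → elements Y ⊆ elements X → ∃[ s ] s ∈ B × s ⊏ Y

-- The field covers forces X to be the increasing enumeration of base B, so
-- this says that base B is infinite and B is a barrier on it.

IsBarrier : Family → Set
IsBarrier B = ∃ λ X → IsBarrierOn X B

-- B as a type. The membership proof is irrelevant, so a function out of
-- Members B depends only on the finite set itself.

Members : Family → Set
Members B = [ s ∈ FinSet ∣ s ∈ B ]

Fibre : {B : Family} → (Members B → ℕ) → ℕ → Set
Fibre {B} f x = [ s ∈ Members B ∣ f s ≡ x ]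

-- A set has at most k elements when it injects into Fin k.

Bounded : ℕ → {B : Family} → (Members B → ℕ) → Set
Bounded k f = ∀ x → Fibre f x ↣ Fin k

{-# OPTIONS --safe #-}
-- Bijecting each fibre of f with a subset of Fin k colours B with k colours in
-- such a way that f is injective on every colour class. So it suffices to find
-- an infinite Z such that the members of B contained in Z all have the same
-- colour (the Nash-Williams partition theorem). That is proved by bar
-- induction on the tree of initial segments of members of B: at a node s,
-- handle the children s ∷ʳ n one after the other while shrinking the infinite
-- set, diagonalise, and thin out the diagonal set by the pigeonhole principle.
module Submission where

open import Defs
open import Axiom.ExcludedMiddle using (ExcludedMiddle)
open import Data.Fin.Base using (Fin; zero; suc)
open import Data.Irrelevant using (Irrelevant; [_])
open import Data.List.Base using (List; []; _∷_; _++_; _∷ʳ_; applyUpTo)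
open import Data.List.Membership.Propositional using () renaming (_∈_ to _∈ˡ_)
open import Data.List.Membership.Propositional.Properties using (∈-++⁺ˡ; ∈-++⁺ʳ)
open import Data.List.Properties using (++-assoc; ++-identityʳ; applyUpTo-∷ʳ)
open import Data.List.Relation.Unary.All as All using (All; []; _∷_)
open import Data.List.Relation.Unary.All.Properties using (applyUpTo⁺₂)
import Data.List.Relation.Unary.AllPairs as AllPairs
open import Data.List.Relation.Unary.Any using (here)
open import Data.List.Relation.Unary.Linked as Linked using (Linked)
open import Data.List.Relation.Unary.Linked.Properties using (Linked⇒AllPairs)
open import Data.Nat.Base using (ℕ; zero; suc; _+_; _<_; _≤_; z≤n; z<s; s<s;
         _≤′_; ≤′-refl; ≤′-step)
import Data.Nat.InfinitelyOften as Often
open import Data.Nat.Properties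
  using (≤-refl; <-trans; <-irrefl; <-asym; <-cmp; _<?_; +-monoˡ-<; ≤⇒≤′; <⇒<′)
open import Data.Product.Base using (Σ-syntax; ∃-syntax; _×_; _,_; proj₁; proj₂; map₂)
open import Data.Refinement.Base using (refine; value; proof; _,_)
open import Data.Refinement.Properties using (value-injective)
open import Data.Sum.Base using (inj₁; inj₂)
open import Function.Base using (_∘_; id)
open import Function.Bundles using (Injection)
open import Function.Definitions using (Injective)
open import Level using (0ℓ)
open import Relation.Binary.Core using (Rel; _Preserves_⟶_)
open import Relation.Binary.Definitions using (tri<; tri≈; tri>)
open import Relation.Binary.PropositionalEquality.Core
  using (_≡_; refl; sym; trans; cong; subst)
open import Relation.Nullary.Decidable using (Dec; decidable-stable; recompute; yes; no)
open import Relation.Nullary.Negation.Core using (¬_; contradiction)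
open import Relation.Unary using (Pred; _∈_; _⊆_)

-- Sortedness and membership are stored irrelevantly; a decision procedure makes them usable as
-- proofs again.
extract : ∀ {A : Set} → Dec A → Irrelevant A → A
extract a? [ a ] = recompute a? a

Linked-++⁻ʳ : ∀ {A : Set} {R : Rel A 0ℓ} xs {ys} → Linked R (xs ++ ys) → Linked R ys
Linked-++⁻ʳ []       l = l
Linked-++⁻ʳ (_ ∷ xs) l = Linked-++⁻ʳ xs (Linked.tail l)

-- Infinite sets as increasing sequences

stepwise-increasing : (f : ℕ → ℕ) → (∀ i → f i < f (suc i)) → f Preserves _<_ ⟶ _<_
stepwise-increasing f f< m<n = go (<⇒<′ m<n)
  where
  go : ∀ {m n} → suc m ≤′ n → f m < f n
  go ≤′-refl      = f< _
  go (≤′-step m<n) = <-trans (go m<n) (f< _)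

enum-cancel-< : ∀ Y {i j} → enum Y i < enum Y j → i < j
enum-cancel-< Y {i} {j} Yi<Yj with <-cmp i j
... | tri< i<j _ _    = i<j
... | tri≈ _ refl _   = contradiction Yi<Yj (<-irrefl refl)
... | tri> _ _ j<i    = contradiction Yi<Yj (<-asym (increasing Y j<i))

head : InfSet → ℕ
head Y = enum Y 0

drop : ℕ → InfSet → InfSet
drop i Y .enum j         = enum Y (j + i)
drop i Y .increasing j<k = increasing Y (+-monoˡ-< i j<k)

drop-⊆ : ∀ i Y → elements (drop i Y) ⊆ elements Y
drop-⊆ i Y (j , eq) = j + i , eq

tail : InfSet → InfSet
tail Y .enum i         = enum Y (suc i)
tail Y .increasing i<j = increasing Y (s<s i<j)

tail-⊆ : ∀ Y → elements (tail Y) ⊆ elements Y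
tail-⊆ Y (i , eq) = suc i , eq

head<tail : ∀ Y {n} → n ∈ elements (tail Y) → head Y < n
head<tail Y (i , refl) = increasing Y z<s

-- The infinite pigeonhole principle

finite-⋃ : ∀ k {P : Fin k → Pred ℕ 0ℓ} →
  (∀ d → Often.Fin (P d)) → Often.Fin (λ i → ∃[ d ] P d i)
finite-⋃ zero    fin = 0 , λ { _ _ (() , _) }
finite-⋃ (suc k) {P} fin =
  map₂ (λ none i le → none i le ∘ split) (fin zero Often.∪-Fin finite-⋃ k (fin ∘ suc))
  where
  split : ∀ {i} → ∃[ d ] P d i → _
  split (zero  , p) = inj₁ p
  split (suc d , p) = inj₂ (d , p)

module _ (em : ExcludedMiddle 0ℓ) where

  Inf⇒InfSet : {P : Pred ℕ 0ℓ} → Often.Inf P → Σ[ I ∈ InfSet ] (∀ j → enum I j ∈ P)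
  Inf⇒InfSet {P} inf = I , enum-∈
    where
    above : ∀ i → ∃[ j ] i ≤ j × j ∈ P
    above i = decidable-stable em λ none → inf (i , λ j i≤j Pj → none (j , i≤j , Pj))

    pick : ℕ → ℕ
    pick zero    = proj₁ (above 0)
    pick (suc i) = proj₁ (above (suc (pick i)))

    I : InfSet
    I .enum       = pick
    I .increasing = stepwise-increasing pick λ i → proj₁ (proj₂ (above (suc (pick i))))

    enum-∈ : ∀ j → pick j ∈ P
    enum-∈ zero    = proj₂ (proj₂ (above 0))
    enum-∈ (suc j) = proj₂ (proj₂ (above (suc (pick j))))

  -- If every colour class were bounded, so would be their finite union, which contains every index.
  infinite-pigeonhole : ∀ {k} (c : ℕ → Fin k) →
    ∃[ d ] Σ[ I ∈ InfSet ] (∀ j → c (enum I j) ≡ d)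
  infinite-pigeonhole {k} c = map₂ (λ {d} → Inf⇒InfSet {P = λ i → c i ≡ d}) (decidable-stable em λ none →
    let i , none≥i = finite-⋃ k λ d → decidable-stable em λ inf → none (d , inf)
    in none≥i i ≤-refl (c i , refl))

  -- Barriers and their restrictions

  module Barrier {X B} (isBarrier : IsBarrierOn X B) where
    open IsBarrierOn isBarrier

    list : Members B → List ℕ
    list t = value (value t)

    sorted : ∀ t → Linked _<_ (list t)
    sorted t = extract (Linked.linked? _<?_ (list t)) (proof (value t))

    member : ∀ t → value t ∈ B
    member t = extract em (proof t)

    -- A proper prefix would be a proper subset, against the antichain condition.
    prefix-free : ∀ t t′ {u} → list t′ ≡ list t ++ u → t ≡ t′
    prefix-free t t′ eq = value-injective (decidable-stable em λ s≢t →
      antichain (member t) (member t′)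
        ((λ n∈t → subst (_ ∈ˡ_) (sym eq) (∈-++⁺ˡ n∈t)) , s≢t))

    -- Some member contains the least element of `X`, and the empty set would be a proper subset of
    -- it.
    nonempty : ∀ {s} → s ∈ B → ¬ value s ≡ []
    nonempty {s} s∈B s≡[] with proj₂ covers (0 , refl)
    ... | t , t∈B , n∈t = antichain s∈B t∈B
      ( (λ n∈s → contradiction (subst (_ ∈ˡ_) s≡[] n∈s) λ ())
      , λ { refl → contradiction (subst (_ ∈ˡ_) s≡[] n∈t) λ () })

    Restriction : InfSet → Family
    Restriction Z s = s ∈ B × All (_∈ elements Z) (value s)

    restriction-isBarrierOn : ∀ Z → elements Z ⊆ elements X → IsBarrierOn Z (Restriction Z)
    restriction-isBarrierOn Z Z⊆X = record
      { covers    = (λ (s , (_ , s⊆Z) , n∈s) → All.lookup s⊆Z n∈s) , Z⊆base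
      ; antichain = λ (s∈B , _) (t∈B , _) → antichain s∈B t∈B
      ; meets     = meets-⊆
      }
      where
      meets-⊆ : ∀ Y → elements Y ⊆ elements Z → ∃[ s ] s ∈ Restriction Z × s ⊏ Y
      meets-⊆ Y Y⊆Z with meets Y (Z⊆X ∘ Y⊆Z)
      ... | s , s∈B , m , eq = s , (s∈B , subst (All _) (sym eq) s⊆Z) , m , eq
        where
        s⊆Z : All (_∈ elements Z) (applyUpTo (enum Y) m)
        s⊆Z = applyUpTo⁺₂ (enum Y) m λ i → Y⊆Z (i , refl)

      Z⊆base : elements Z ⊆ base (Restriction Z)
      -- The nonempty member met by `Z` from index `i` onwards has `enum Z i` as its first element.
      Z⊆base (i , refl) with meets-⊆ (drop i Z) (drop-⊆ i Z)
      ... | s , s∈R , zero  , eq = contradiction eq (nonempty (proj₁ s∈R))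
      ... | s , s∈R , suc m , eq = s , s∈R , subst (_ ∈ˡ_) (sym eq) (here refl)

    -- The tree of initial segments

    infix 4 _Extends_

    _Extends_ : Members B → List ℕ → Set
    t Extends s = ∃[ u ] list t ≡ s ++ u

    -- Junk nodes, which no member of B extends, count as leaves. This makes
    -- the bar induction independent of X and of sortedness.
    Leaf : List ℕ → Set
    Leaf s = ∀ t t′ → t Extends s → t′ Extends s → t ≡ t′

    -- Well-foundedness as an inductive predicate, so that recursion can follow it. As members are
    -- leaves, `¬ Leaf s` guarantees that `s` is not itself a member.
    data Bar (s : List ℕ) : Set where
      leaf : Leaf s → Bar s
      node : ¬ Leaf s → (∀ n → Bar (s ∷ʳ n)) → Bar s

    member⇒leaf : ∀ t → Leaf (list t)
    member⇒leaf t t₁ t₂ (_ , eq₁) (_ , eq₂) =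
      trans (sym (prefix-free t t₁ eq₁)) (prefix-free t t₂ eq₂)

    ¬Bar⇒extends : ∀ {s} → ¬ Bar s → ∃[ t ] t Extends s
    ¬Bar⇒extends ¬bar = decidable-stable em λ none →
      ¬bar (leaf λ t _ ext _ → contradiction (t , ext) none)

    ¬Bar⇒child : ∀ {s} → ¬ Bar s → ∃[ n ] ¬ Bar (s ∷ʳ n)
    ¬Bar⇒child ¬bar = decidable-stable em λ none →
      ¬bar (node (¬bar ∘ leaf) λ n → decidable-stable em λ ¬barₙ → none (n , ¬barₙ))

    -- Otherwise some infinite path avoids Bar. All its nodes extend to members
    -- of B, so it enumerates an infinite subset of X, and thus meets B.
    Bar-[] : Bar []
    Bar-[] = decidable-stable em λ ¬bar → let open Path ¬bar in ¬Bar-member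
      where
      module Path (¬bar : ¬ Bar []) where
        grow : ∃[ s ] ¬ Bar s → ∃[ s ] ¬ Bar s
        grow (s , ¬barₛ) = let n , ¬barₙ = ¬Bar⇒child ¬barₛ in s ∷ʳ n , ¬barₙ

        path : ℕ → ∃[ s ] ¬ Bar s
        path zero    = [] , ¬bar
        path (suc i) = grow (path i)

        next : ℕ → ℕ
        next i = proj₁ (¬Bar⇒child (proj₂ (path i)))

        path≡applyUpTo : ∀ i → proj₁ (path i) ≡ applyUpTo next i
        path≡applyUpTo zero    = refl
        path≡applyUpTo (suc i) =
          trans (cong (_∷ʳ next i) (path≡applyUpTo i)) (applyUpTo-∷ʳ next i)

        next< : ∀ i → next i < next (suc i)
        next< i with ¬Bar⇒extends (proj₂ (path (suc (suc i))))
        ... | t , u , eq = Linked.head (Linked-++⁻ʳ s (subst (Linked _<_) eq′ (sorted t)))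
          where
          s = proj₁ (path i)
          a = next i
          b = next (suc i)
          eq′ : list t ≡ s ++ a ∷ b ∷ u
          eq′ = trans eq (trans (++-assoc (s ∷ʳ a) (b ∷ []) u) (++-assoc s (a ∷ []) (b ∷ u)))

        next-∈ : ∀ i → next i ∈ elements X
        next-∈ i with ¬Bar⇒extends (proj₂ (path (suc i)))
        ... | t , u , eq = proj₁ covers (value t , member t ,
          subst (_ ∈ˡ_) (sym eq) (∈-++⁺ˡ (∈-++⁺ʳ (proj₁ (path i)) (here refl))))

        Y : InfSet
        Y .enum       = next
        Y .increasing = stepwise-increasing next next<

        ¬Bar-member : _
        ¬Bar-member with meets Y (λ { (i , refl) → next-∈ i })
        ... | s , s∈B , m , eq = proj₂ (path m)
          (subst Bar (trans eq (sym (path≡applyUpTo m))) (leaf (member⇒leaf (s , [ s∈B ]))))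

    -- Homogeneous sets by fusion

    module _ {k} (χ : Members B → Fin k) where

      -- Only the part after `s` must lie in `Z`, so `Z` may be thinned past the elements of `s`. At
      -- `[]` this is full monochromaticity.
      Homogeneous : List ℕ → InfSet → Fin k → Set
      Homogeneous s Z d = ∀ t u → list t ≡ s ++ u → All (_∈ elements Z) u → χ t ≡ d

      HomogeneousWithin : List ℕ → InfSet → Set
      HomogeneousWithin s Y =
        Σ[ Z ∈ InfSet ] elements Z ⊆ elements Y × ∃[ d ] Homogeneous s Z d

      module Fusion {s} (¬leaf : ¬ Leaf s)
                    (child : ∀ n Y → HomogeneousWithin (s ∷ʳ n) Y) (Y : InfSet) where

        -- Each head is set aside for the diagonal `W`; shrinking the tail, not the whole set, keeps
        -- the heads strictly increasing.
        stage : ℕ → InfSet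
        stage zero    = Y
        stage (suc i) = proj₁ (child (head (stage i)) (tail (stage i)))

        colour : ℕ → Fin k
        colour i = proj₁ (proj₂ (proj₂ (child (head (stage i)) (tail (stage i)))))

        stage-homogeneous : ∀ i → Homogeneous (s ∷ʳ head (stage i)) (stage (suc i)) (colour i)
        stage-homogeneous i = proj₂ (proj₂ (proj₂ (child (head (stage i)) (tail (stage i)))))

        stage-suc-⊆ : ∀ i → elements (stage (suc i)) ⊆ elements (tail (stage i))
        stage-suc-⊆ i = proj₁ (proj₂ (child (head (stage i)) (tail (stage i))))

        stage-⊆ : ∀ {i j} → i ≤′ j → elements (stage j) ⊆ elements (stage i)
        stage-⊆ ≤′-refl             = id
        stage-⊆ (≤′-step {j} i≤j) n∈ = stage-⊆ i≤j (tail-⊆ (stage j) (stage-suc-⊆ j n∈))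

        W : InfSet
        W .enum i     = head (stage i)
        W .increasing = stepwise-increasing _ λ i →
          head<tail (stage i) (stage-suc-⊆ i (0 , refl))

        -- A larger diagonal element has a later index, and the stages decrease.
        later-∈ : ∀ i {n} → enum W i < n → n ∈ elements W → n ∈ elements (stage (suc i))
        later-∈ i Wi<n (j , refl) = stage-⊆ (≤⇒≤′ (enum-cancel-< W {i} {j} Wi<n)) (0 , refl)

        homogeneous : HomogeneousWithin s Y
        homogeneous with infinite-pigeonhole colour
        ... | d , I , colour≡d = Z , Z⊆Y , d , hom
          where
          Z : InfSet
          Z .enum j     = enum W (enum I j)
          Z .increasing = increasing W ∘ increasing I

          Z⊆W : elements Z ⊆ elements W
          Z⊆W (j , eq) = enum I j , eq

          Z⊆Y : elements Z ⊆ elements Y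
          Z⊆Y (j , refl) = stage-⊆ {j = enum I j} (≤⇒≤′ z≤n) (0 , refl)

          hom : Homogeneous s Z d
          hom t []      eq _ =
            contradiction (subst Leaf (trans eq (++-identityʳ s)) (member⇒leaf t)) ¬leaf
          -- After `s`, the member continues with some `W i`. By sortedness the rest exceeds `W i`,
          -- so it lies in the stage homogeneous for `s ∷ʳ enum W i`.
          hom t (_ ∷ u) eq ((j , refl) ∷ u⊆Z) = trans
            (stage-homogeneous i t u (trans eq (sym (++-assoc s _ u)))
              (All.zipWith (λ (Wi<n , n∈Z) → later-∈ i Wi<n (Z⊆W n∈Z)) (Wi<u , u⊆Z)))
            (colour≡d j)
            where
            i = enum I j
            Wi<u : All (enum W i <_) u
            Wi<u = AllPairs.head (Linked⇒AllPairs <-trans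
              (Linked-++⁻ʳ s (subst (Linked _<_) eq (sorted t))))

      Bar⇒homogeneous : Fin k → ∀ {s} → Bar s → ∀ Y → HomogeneousWithin s Y
      Bar⇒homogeneous d₀ {s} (leaf unique) Y with em {∃[ t ] t Extends s}
      -- At most one member extends a leaf, so its colour serves; `d₀` is the default when there is
      -- none.
      ... | yes (t , ext) = Y , id , χ t , λ t′ u eq _ → cong χ (unique t′ t (u , eq) ext)
      ... | no none       = Y , id , d₀ , λ t u eq _ → contradiction (t , u , eq) none
      Bar⇒homogeneous d₀ (node ¬leaf child) =
        Fusion.homogeneous ¬leaf λ n → Bar⇒homogeneous d₀ (child n)

      nash-williams : Σ[ Z ∈ InfSet ] elements Z ⊆ elements X ×
        ∃[ d ] (∀ t → All (_∈ elements Z) (list t) → χ t ≡ d)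
      nash-williams with meets X id
      -- A member met by `X` supplies the default colour, which shows that `Fin k` is inhabited.
      ... | s , s∈B , _ with Bar⇒homogeneous (χ (s , [ s∈B ])) Bar-[] X
      ... | Z , Z⊆X , d , hom = Z , Z⊆X , d , λ t → hom t (list t) refl

-- Colouring along the fibres

module _ {B : Family} {k : ℕ} (f : Members B → ℕ) (bounded : Bounded k f) where

  fibreColour : Members B → Fin k
  fibreColour s = Injection.to (bounded (f s)) (s , [ refl ])

  -- The colours of `s` and `t` come from the injections at `f s` and `f t`; transport along an
  -- equality brings both to one fibre, where injectivity applies.
  fibreColour≡to : ∀ {s x} (fs≡x : f s ≡ x) →
    fibreColour s ≡ Injection.to (bounded x) (s , [ fs≡x ])
  fibreColour≡to refl = refl

  fibreColour-separates : ∀ {s t} → f s ≡ f t → fibreColour s ≡ fibreColour t → s ≡ t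
  fibreColour-separates {s} {t} fs≡ft eq = cong value
    (Injection.injective (bounded (f t)) (trans (sym (fibreColour≡to fs≡ft)) eq))

mainTheorem3 : ExcludedMiddle 0ℓ →
    (X : InfSet) (B : Family) → IsBarrierOn X B →
    (k : ℕ) (f : Members B → ℕ) → Bounded k f →
    Σ[ B′ ∈ Family ] Σ[ B′⊆B ∈ B′ ⊆ B ]
    (IsBarrier B′ × Injective _≡_ _≡_ (f ∘ refine B′⊆B))
mainTheorem3 em X B isBarrier k f bounded
  with Barrier.nash-williams em isBarrier (fibreColour f bounded)
... | Z , Z⊆X , d , constant =
  Restriction Z , proj₁ , (Z , restriction-isBarrierOn Z Z⊆X) ,
  λ {s} {t} fs≡ft → value-injective (cong value
    (fibreColour-separates f bounded fs≡ft (trans (monochrome s) (sym (monochrome t)))))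
  where
  open Barrier em isBarrier
  monochrome : ∀ s → fibreColour f bounded (refine proj₁ s) ≡ d
  monochrome s = constant (refine proj₁ s) (proj₂ (extract em (proof s)))
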